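{- Let $\theta\in(0,1)$. For every demand sequence $\mathbf{D}$ with $\mathit{OPT}(\mathbf{D})>0$ and every prediction $y$ with total prediction error $\eta$, $$\frac{\mathcal{C}(\mathbf{D},\mathrm{LADTSR})}{\mathit{OPT}(\mathbf{D})}\le \min\left\{1+\theta+\theta^2+\frac{1+2\theta}{1-\theta}\cdot\frac{\eta}{\mathit{OPT}(\mathbf{D})},\ 1+\theta^{ -1}+\theta^{ -3}\right\}.$$ Furthermore, LADTSR is $(1+\theta+\theta^2)$-consistent and $(1+\theta^{ -1}+\theta^{ -3})$-robust.
   Context: **Problem (two-level ski-rental).** There are $K$ items, an integer single purchase price $C_s>1$ and an integer combo purchase price $C_c$ with $C_s < C_c < K C_s$. Time is slotted, $t=1,\dots,T$, where the finite horizon $T$ is arbitrary and unknown to the online algorithm. A demand sequence is $\mathbf{D}=\{d(t)\}_{t=1}^T$ with $d(t)=(i(t),a(t))$, where $i(t)\in\{1,\dots,K\}$ is an item and $a(t)$ is a non-negative integer (amount of demand for that item); $d(t)=(0,0)$ means that there is no demand in slot $t$ (no action is then required or taken). A solution consists of rental decisions $r(t)\in\{0,1\}$, single purchase times $t_k \in\{1,2,\dots\}\cup\{\infty\}$ for $k=1,\dots,K$ ($\infty$ if never made), and a combo purchase time $t_c\in\{1,2,\dots\}\cup\{\infty\}$. It is feasible if in every slot $t$ with a demand, $r(t)+\mathbf{1}_{\{t\ge t_{i(t)}\}}+\mathbf{1}_{\{t\ge t_c\}}\ge 1$. Its cost is $\sum_{t=1}^T a(t)r(t)+\sum_{k=1}^K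 C_s\mathbf{1}_{\{t_k\le T\}}+C_c\mathbf{1}_{\{t_c\le T\}}$. $\mathcal{C}(\mathbf{D},\pi)$ is the cost of algorithm $\pi$ on $\mathbf{D}$, and $\mathit{OPT}(\mathbf{D})$ is the minimum cost of a feasible solution for $\mathbf{D}$ (with full knowledge of $\mathbf{D}$). **Predictions.** The total demand of $\mathbf{D}$ is $z=(z_1,\dots,z_K)$ with $z_k=\sum_{t=1}^T\mathbf{1}_{\{i(t)=k\}}a(t)$. A prediction is a vector $y=(y_1,\dots,y_K)$ of non-negative numbers (predicted total demands), given at the start. The errors are $\eta_k=|y_k-z_k|$ and $\eta=\sum_{k=1}^K\eta_k$. A learning-augmented algorithm $\pi$ is $\alpha$-consistent if $\mathcal{C}(\mathbf{D},\pi)\le\alpha\cdot\mathit{OPT}(\mathbf{D})$ for every $\mathbf{D}$ whenever $\eta=0$, and $\beta$-robust if $\mathcal{C}(\mathbf{D},\pi)\le\beta\cdot\mathit{OPT}(\mathbf{D})$ for every $\mathbf{D}$ and every prediction, regardless of $\eta$. **Algorithm LADTSR** with trust parameter $\theta\in(0,1)$. Given $y$, set for each item $k$: $\lambda_{s,k}=\theta C_s$ if $y_k\ge C_s$, and $\lambda_{s,k}=C_s/\theta$ otherwise. Set $\lambda_c=\theta^2C_c$ if $\sum_{k=1}^K\min\{C_s,y_k\}\ge C_c$, and $\lambda_c=C_c/\theta$ otherwise. Then run the following online procedure. Initially $\psi_k(0)=0$, $t_k=\infty$ for all $k$, $t_c=\infty$, and $r(t)=0$ for all $t$. When a demand $d(t)=(i(t),a(t))$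 arrives in slot $t$: 1. Update: $\psi_k(t)=\psi_k(t-1)+a(t)$ if $k=i(t)$ and the demand is not covered by an earlier purchase (i.e. neither a single purchase of item $k$ nor a combo purchase has been made before slot $t$); otherwise $\psi_k(t)=\psi_k(t-1)$. Set $\psi_c(t)=\sum_{k=1}^K\min\{\psi_k(t),\lambda_{s,k}\}$. 2. If the demand is covered by an earlier single purchase of item $i(t)$ or by an earlier combo purchase, do nothing. 3. Otherwise: if $\psi_c(t)\ge\lambda_c$, make the combo purchase ($t_c=t$); else if $\psi_{i(t)}(t)\ge\lambda_{s,i(t)}$, make the single purchase of item $i(t)$ ($t_{i(t)}=t$); else rent ($r(t)=1$). -}

module Defs where

open import Level using (Level; suc; _⊔_)
open import Algebra.Bundles using (CommutativeRing)
open import Algebra.Structures using (IsCommutativeRing)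
open import Data.Bool.Base using (Bool; true; false; if_then_else_; _∨_)
open import Data.Fin.Base using (Fin; toℕ)
import Data.Fin.Properties as Fin
open import Data.Maybe.Base using (Maybe; just; nothing; is-just)
open import Data.Nat.Base as ℕ using (ℕ; _<ᵇ_)
open import Data.Nat.Properties using (+-0-commutativeMonoid)
open import Data.Product.Base using (Σ-syntax; _×_; _,_)
open import Data.Vec.Functional using (Vector; []; _∷_; head; tail; updateAt)
open import Relation.Binary.Bundles using (DecTotalOrder)
open import Relation.Binary.Core using (Rel)
open import Relation.Binary.PropositionalEquality.Core using (_≡_)
open import Relation.Binary.Structures using (IsDecTotalOrder)
open import Relation.Nullary using (¬_; does)
import Algebra.Construct.NaturalChoice.Max as Max
import Algebra.Construct.NaturalChoice.Min as Min
import Algebra.Properties.CommutativeMonoid.Sum as Sum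
import Algebra.Properties.Semiring.Exp as Exp
import Algebra.Properties.Semiring.Mult as Mult
import Relation.Binary.Construct.NonStrictToStrict as NonStrictToStrict

-- The real numbers enter only through their ordered-field structure.  The
-- order is decidable because the algorithm branches on comparisons.
-- The value of 0# ⁻¹ is left unspecified.

record OrderedField c ℓ₁ ℓ₂ : Set (suc (c ⊔ ℓ₁ ⊔ ℓ₂)) where
  infix  8 -_ _⁻¹
  infixl 7 _*_
  infixl 6 _+_
  infix  4 _≈_ _≤_
  field
    Carrier           : Set c
    _≈_               : Rel Carrier ℓ₁
    _≤_               : Rel Carrier ℓ₂
    _+_ _*_           : Carrier → Carrier → Carrier
    -_ _⁻¹            : Carrier → Carrier
    0# 1#             : Carrier
    isCommutativeRing : IsCommutativeRing _≈_ _+_ _*_ -_ 0# 1#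
    isDecTotalOrder   : IsDecTotalOrder _≈_ _≤_
    0≉1               : ¬ 0# ≈ 1#
    ⁻¹-cong           : ∀ {x y} → x ≈ y → x ⁻¹ ≈ y ⁻¹
    ⁻¹-inverseʳ       : ∀ x → ¬ x ≈ 0# → x * x ⁻¹ ≈ 1#
    +-monoˡ-≤         : ∀ z {x y} → x ≤ y → x + z ≤ y + z
    *-nonNegative     : ∀ {x y} → 0# ≤ x → 0# ≤ y → 0# ≤ x * y

  commutativeRing : CommutativeRing c ℓ₁
  commutativeRing = record { isCommutativeRing = isCommutativeRing }

  decTotalOrder : DecTotalOrder c ℓ₁ ℓ₂
  decTotalOrder = record { isDecTotalOrder = isDecTotalOrder }

  open CommutativeRing commutativeRing public
    using (_-_; semiring; +-commutativeMonoid)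
  open DecTotalOrder decTotalOrder public using (_≤?_; totalOrder)
  open NonStrictToStrict _≈_ _≤_ public using (_<_)
  open Min totalOrder public using () renaming (_⊓_ to min)
  open Max totalOrder public using () renaming (_⊔_ to max)
  open Exp semiring public using (_^_)
  open Mult semiring using () renaming (_×_ to _·_)

  infixl 7 _/_
  _/_ : Carrier → Carrier → Carrier
  x / y = x * y ⁻¹

  ∣_∣ : Carrier → Carrier
  ∣ x ∣ = max x (- x)

  fromℕ : ℕ → Carrier
  fromℕ n = n · 1#

record Instance : Set where
  field
    K Cₛ C꜀  : ℕ
    1<Cₛ     : 1 ℕ.< Cₛ
    Cₛ<C꜀    : Cₛ ℕ.< C꜀
    C꜀<K*Cₛ  : C꜀ ℕ.< K ℕ.* Cₛ

𝟙 : Bool → ℕ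
𝟙 b = if b then 1 else 0

module SkiRental (I : Instance) where
  open Instance I
  open Sum +-0-commutativeMonoid using (sum-syntax)

  -- `nothing` is a slot without demand.
  Demand : Set
  Demand = Maybe (Fin K × ℕ)

  -- Slot t ∈ {1,…,T} is the index j : Fin T with t = suc (toℕ j).
  Demands : ℕ → Set
  Demands T = Vector Demand T

  amount : Demand → ℕ
  amount (just (_ , a)) = a
  amount nothing        = 0

  amountFor : Fin K → Demand → ℕ
  amountFor k (just (i , a)) = 𝟙 (does (i Fin.≟ k)) ℕ.* a
  amountFor k nothing        = 0

  totalDemand : ∀ {T} → Demands T → Vector ℕ K
  totalDemand {T} D k = ∑[ j < T ] amountFor k (D j)

  -- `just s` is the purchase time s + 1 ∈ {1,2,…}; `nothing` is ∞.
  Time : Set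
  Time = Maybe ℕ

  -- madeBy τ t  is  τ ≤ t.
  madeBy : Time → ℕ → Bool
  madeBy (just s) t = s <ᵇ t
  madeBy nothing  t = false

  record Solution (T : ℕ) : Set where
    field
      rent   : Vector Bool T
      single : Vector Time K
      combo  : Time

  Feasible : ∀ {T} → Demands T → Solution T → Set
  Feasible D S = ∀ j i a → D j ≡ just (i , a) → let t = ℕ.suc (toℕ j) in
    𝟙 (rent j) ℕ.+ 𝟙 (madeBy (single i) t) ℕ.+ 𝟙 (madeBy combo t) ℕ.≥ 1
    where open Solution S

  cost : ∀ {T} → Demands T → Solution T → ℕ
  cost {T} D S =
    ∑[ j < T ] (amount (D j) ℕ.* 𝟙 (rent j))
      ℕ.+ ∑[ k < K ] (Cₛ ℕ.* 𝟙 (madeBy (single k) T))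
      ℕ.+ C꜀ ℕ.* 𝟙 (madeBy combo T)
    where open Solution S

  -- v is the minimum cost of a feasible solution.  Buying the combo in the first
  -- slot is feasible and costs are natural numbers, so there is exactly one such v.
  IsOPT : ∀ {T} → Demands T → ℕ → Set
  IsOPT {T} D v =
    (Σ[ S ∈ Solution T ] (Feasible D S × cost D S ≡ v)) ×
    (∀ (S : Solution T) → Feasible D S → v ℕ.≤ cost D S)

module LearningAugmented {c ℓ₁ ℓ₂} (F : OrderedField c ℓ₁ ℓ₂) (I : Instance) where
  open OrderedField F
  open Instance I
  open SkiRental I
  open Sum +-commutativeMonoid using (sum-syntax)

  Prediction : Set c
  Prediction = Vector Carrier K

  NonNegative : Prediction → Set ℓ₂
  NonNegative y = ∀ k → 0# ≤ y k

  error : ∀ {T} → Prediction → Demands T → Carrier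
  error y D = ∑[ k < K ] ∣ y k - fromℕ (totalDemand D k) ∣

  -- Online-ness is not part of this type; LADTSR reads the slots in order.
  Algorithm : Set c
  Algorithm = Prediction → ∀ {T} → Demands T → Solution T

  𝒞 : ∀ {T} → Demands T → Algorithm → Prediction → ℕ
  𝒞 D π y = cost D (π y D)

  Consistent : Carrier → Algorithm → Set (c ⊔ ℓ₁ ⊔ ℓ₂)
  Consistent α π = ∀ {T} (D : Demands T) y → NonNegative y → error y D ≈ 0# →
    ∀ opt → IsOPT D opt → fromℕ (𝒞 D π y) ≤ α * fromℕ opt

  Robust : Carrier → Algorithm → Set (c ⊔ ℓ₂)
  Robust β π = ∀ {T} (D : Demands T) y → NonNegative y →
    ∀ opt → IsOPT D opt → fromℕ (𝒞 D π y) ≤ β * fromℕ opt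

  module _ (θ : Carrier) (y : Prediction) where

    λₛ : Vector Carrier K
    λₛ k = if does (fromℕ Cₛ ≤? y k) then θ * fromℕ Cₛ else fromℕ Cₛ / θ

    λ꜀ : Carrier
    λ꜀ = if does (fromℕ C꜀ ≤? ∑[ k < K ] min (fromℕ Cₛ) (y k))
           then θ ^ 2 * fromℕ C꜀ else fromℕ C꜀ / θ

    -- The state between two slots; it records only purchases already made.
    record State : Set where
      field
        ψ      : Vector ℕ K
        single : Vector Time K
        combo  : Time

    initial : State
    initial = record { ψ = λ _ → 0 ; single = λ _ → nothing ; combo = nothing }

    -- Slot s + 1: whether to rent, and the next state.
    step : ℕ → Demand → State → Bool × State
    step s nothing        σ = false , σ
    step s (just (i , a)) σ =
      if is-just (single i) ∨ is-just combo then false , σ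
      else if does (λ꜀ ≤? ψ꜀)
        then false , record { ψ = ψ′ ; single = single ; combo = just s }
      else if does (λₛ i ≤? fromℕ (ψ′ i))
        then false , record { ψ = ψ′ ; single = updateAt single i (λ _ → just s) ; combo = combo }
      else true , record { ψ = ψ′ ; single = single ; combo = combo }
      where
        open State σ
        ψ′ : Vector ℕ K
        ψ′ = updateAt ψ i (ℕ._+ a)
        ψ꜀ : Carrier
        ψ꜀ = ∑[ k < K ] min (fromℕ (ψ′ k)) (λₛ k)

    -- Process the demands of slots s + 1, s + 2, … in order.
    run : ∀ {T} → ℕ → Demands T → State → Vector Bool T × State
    run {ℕ.zero}  s D σ = [] , σ
    run {ℕ.suc T} s D σ =
      let r  , σ₁ = step s (head D) σ
          rs , σ₂ = run (ℕ.suc s) (tail D) σ₁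
      in r ∷ rs , σ₂

  LADTSR : Carrier → Algorithm
  LADTSR θ y D =
    let rs , σ = run θ y 0 D (initial θ y)
    in record { rent = rs ; single = State.single σ ; combo = State.combo σ }

module Submission where

-- Every item is charged against its share of the combo counter ψ꜀: its rent if it was only
-- rented, its threshold λₛ if it was purchased.  The charges sum to at most λ꜀, and the cost
-- of an item is at most 1 + 1/θ times its charge.  Offline, either the combo price C or
-- X = Σ min(Cₛ, z_k) bounds OPT from below.
-- Robustness: if OPT ≥ C use charges ≤ λ꜀ ≤ C/θ; if OPT ≥ X bound each item by
-- (1 + 1/θ) min(Cₛ, z_k), and a combo purchase by θ² C ≤ λ꜀ ≤ ψ꜀ ≤ X/θ.
-- Smoothness: with P = Σ min(Cₛ, y_k), if C ≤ P the cost is at most (1 + 1/θ) θ² C + C and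
-- C ≤ P ≤ X + η.  If P ≤ C, each item costs at most (1 + θ) w with w ≤ min(Cₛ, y_k) + η_k and
-- w ≤ min(Cₛ, z_k) + η_k / (1 - θ), and a combo purchase forces C/θ ≤ ψ꜀ ≤ C + η, whence
-- C ≤ θ η / (1 - θ).

open import Defs
open import Level using (_⊔_)
open import Algebra.Bundles using (CommutativeRing)
open import Data.Bool.Base as Bool using (Bool; true; false; if_then_else_; _∨_)
open import Data.Bool.Properties using (∨-conicalʳ)
open import Data.Fin.Base using (Fin; zero; suc)
import Data.Fin.Properties as Fin
open import Data.Maybe.Base using (just; nothing; is-just)
open import Data.Nat.Base as ℕ using (ℕ)
import Data.Nat.Properties as ℕ
open import Data.Product.Base using (Σ-syntax; _×_; _,_; proj₁; proj₂)
open import Data.Sum.Base using (_⊎_; inj₁; inj₂; [_,_]′)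
open import Data.Vec.Functional using (Vector; head; tail; updateAt)
open import Data.Vec.Functional.Properties using (updateAt-updates; updateAt-minimal)
open import Function.Base using (_∘_)
open import Relation.Binary.Bundles using (DecTotalOrder)
open import Relation.Binary.PropositionalEquality.Core as ≡ using (_≡_; _≢_)
open import Relation.Nullary using (¬_; does; yes; no; contradiction)
open import Relation.Nullary.Decidable using (dec-true)
import Algebra.Construct.NaturalChoice.Max as Max
import Algebra.Construct.NaturalChoice.Min as Min
import Algebra.Properties.Ring as RingProperties
import Algebra.Properties.Semiring.Mult as Mult
import Algebra.Properties.Semiring.Sum as SemiringSum
import Algebra.Solver.Ring.NaturalCoefficients.Default as SemiringSolver
import Relation.Binary.Reasoning.PartialOrder as ≤-Reasoning

-- Ordered-field arithmetic, absolute values, minima and finite sums.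

module OrderedFieldProperties {c ℓ₁ ℓ₂} (F : OrderedField c ℓ₁ ℓ₂) where
  open OrderedField F
  open CommutativeRing commutativeRing public
    using (refl; sym; trans; reflexive; commutativeSemiring; ring;
           +-congˡ; +-congʳ; +-comm; +-assoc; +-identityˡ; +-identityʳ; -‿inverseˡ; -‿inverseʳ;
           *-congˡ; *-congʳ; *-comm; *-assoc; *-identityˡ; *-identityʳ; distribˡ; distribʳ; zeroʳ)
  open RingProperties ring using (-‿distribʳ-*; -‿involutive)
  open DecTotalOrder decTotalOrder public
    using (poset; total; antisym)
    renaming (refl to ≤-refl; reflexive to ≤-reflexive; trans to ≤-trans)
  open Mult semiring using (×-homo-+)
  open SemiringSum semiring public using (sum; sum-syntax; ∑-distrib-+; *-distribˡ-sum)
  open SemiringSolver commutativeSemiring public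
    using (solve; con; _:=_; _:+_; _:*_; _:^_)
  open ≤-Reasoning poset public

  +-monoʳ-≤ : ∀ z {x y} → x ≤ y → z + x ≤ z + y
  +-monoʳ-≤ z {x} {y} x≤y = begin
    z + x ≈⟨ +-comm z x ⟩
    x + z ≤⟨ +-monoˡ-≤ z x≤y ⟩
    y + z ≈⟨ +-comm y z ⟩
    z + y ∎

  +-mono-≤ : ∀ {x y u v} → x ≤ y → u ≤ v → x + u ≤ y + v
  +-mono-≤ {y = y} {u = u} x≤y u≤v = ≤-trans (+-monoˡ-≤ u x≤y) (+-monoʳ-≤ y u≤v)

  +-nonNegative : ∀ {x y} → 0# ≤ x → 0# ≤ y → 0# ≤ x + y
  +-nonNegative 0≤x 0≤y = ≤-trans (≤-reflexive (sym (+-identityˡ 0#))) (+-mono-≤ 0≤x 0≤y)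

  x≤x+y : ∀ {x y} → 0# ≤ y → x ≤ x + y
  x≤x+y {x} 0≤y = ≤-trans (≤-reflexive (sym (+-identityʳ x))) (+-monoʳ-≤ x 0≤y)

  x-y+y≈x : ∀ x y → x - y + y ≈ x
  x-y+y≈x x y = trans (+-assoc x (- y) y) (trans (+-congˡ (-‿inverseˡ y)) (+-identityʳ x))

  x≤y⇒0≤y-x : ∀ {x y} → x ≤ y → 0# ≤ y - x
  x≤y⇒0≤y-x {x} x≤y = ≤-trans (≤-reflexive (sym (-‿inverseʳ x))) (+-monoˡ-≤ (- x) x≤y)

  +-cancelʳ-≤ : ∀ z {x y} → x + z ≤ y + z → x ≤ y
  +-cancelʳ-≤ z {x} {y} x+z≤y+z = begin
    x           ≈⟨ cancel x ⟨
    x + z - z   ≤⟨ +-monoˡ-≤ (- z) x+z≤y+z ⟩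
    y + z - z   ≈⟨ cancel y ⟩
    y           ∎
    where
    cancel : ∀ w → w + z - z ≈ w
    cancel w = trans (+-assoc w z (- z)) (trans (+-congˡ (-‿inverseʳ z)) (+-identityʳ w))

  *-monoʳ-≤ : ∀ {z x y} → 0# ≤ z → x ≤ y → z * x ≤ z * y
  *-monoʳ-≤ {z} {x} {y} 0≤z x≤y = begin
    z * x                   ≈⟨ +-identityˡ (z * x) ⟨
    0# + z * x              ≤⟨ +-monoˡ-≤ (z * x) (*-nonNegative 0≤z (x≤y⇒0≤y-x x≤y)) ⟩
    z * (y - x) + z * x     ≈⟨ distribˡ z (y - x) x ⟨
    z * (y - x + x)         ≈⟨ *-congˡ (x-y+y≈x y x) ⟩
    z * y                   ∎

  *-monoˡ-≤ : ∀ {z x y} → 0# ≤ z → x ≤ y → x * z ≤ y * z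
  *-monoˡ-≤ {z} {x} {y} 0≤z x≤y = begin
    x * z ≈⟨ *-comm x z ⟩
    z * x ≤⟨ *-monoʳ-≤ 0≤z x≤y ⟩
    z * y ≈⟨ *-comm z y ⟩
    y * z ∎

  1≤y⇒x≤y*x : ∀ {x y} → 0# ≤ x → 1# ≤ y → x ≤ y * x
  1≤y⇒x≤y*x {x} 0≤x 1≤y = ≤-trans (≤-reflexive (sym (*-identityˡ x))) (*-monoˡ-≤ 0≤x 1≤y)

  y≤1⇒y*x≤x : ∀ {x y} → 0# ≤ x → y ≤ 1# → y * x ≤ x
  y≤1⇒y*x≤x {x} 0≤x y≤1 = ≤-trans (*-monoˡ-≤ 0≤x y≤1) (≤-reflexive (*-identityˡ x))

  -- In the case `1# ≤ 0#` the element `- 1#` is nonnegative, and 1 is its square.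
  0≤1 : 0# ≤ 1#
  0≤1 with total 0# 1#
  ... | inj₁ 0≤1# = 0≤1#
  ... | inj₂ 1≤0  = begin
    0#              ≤⟨ *-nonNegative 0≤-1 0≤-1 ⟩
    - 1# * - 1#     ≈⟨ -‿distribʳ-* (- 1#) 1# ⟨
    - (- 1# * 1#)   ≈⟨ -‿cong (*-identityʳ (- 1#)) ⟩
    - - 1#          ≈⟨ -‿involutive 1# ⟩
    1#              ∎
    where
    open CommutativeRing commutativeRing using (-‿cong)
    0≤-1 : 0# ≤ - 1#
    0≤-1 = ≤-trans (x≤y⇒0≤y-x 1≤0) (≤-reflexive (+-identityˡ (- 1#)))

  1≰0 : ¬ 1# ≤ 0#
  1≰0 1≤0 = 0≉1 (antisym 0≤1 1≤0)

  x*x⁻¹≈1 : ∀ {x} → 0# < x → x * x ⁻¹ ≈ 1#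
  x*x⁻¹≈1 {x} (_ , 0≉x) = ⁻¹-inverseʳ x (0≉x ∘ sym)

  ⁻¹-nonNegative : ∀ {x} → 0# < x → 0# ≤ x ⁻¹
  ⁻¹-nonNegative {x} 0<x@(0≤x , _) with total 0# (x ⁻¹)
  ... | inj₁ 0≤x⁻¹ = 0≤x⁻¹
  ... | inj₂ x⁻¹≤0 = contradiction 1≤0 1≰0
    where
    1≤0 : 1# ≤ 0#
    1≤0 = begin
      1#        ≈⟨ x*x⁻¹≈1 0<x ⟨
      x * x ⁻¹  ≤⟨ *-monoʳ-≤ 0≤x x⁻¹≤0 ⟩
      x * 0#    ≈⟨ zeroʳ x ⟩
      0#        ∎

  1≤x⁻¹ : ∀ {x} → 0# < x → x ≤ 1# → 1# ≤ x ⁻¹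
  1≤x⁻¹ 0<x x≤1 = ≤-trans (≤-reflexive (sym (x*x⁻¹≈1 0<x))) (y≤1⇒y*x≤x (⁻¹-nonNegative 0<x) x≤1)

  x≤∣x∣ : ∀ x → x ≤ ∣ x ∣
  x≤∣x∣ x = Max.x≤x⊔y totalOrder x (- x)

  -x≤∣x∣ : ∀ x → - x ≤ ∣ x ∣
  -x≤∣x∣ x = Max.x≤y⊔x totalOrder x (- x)

  0≤∣x∣ : ∀ x → 0# ≤ ∣ x ∣
  0≤∣x∣ x with total 0# x
  ... | inj₁ 0≤x = ≤-trans 0≤x (x≤∣x∣ x)
  ... | inj₂ x≤0 = begin
    0#     ≤⟨ x≤y⇒0≤y-x x≤0 ⟩
    0# - x ≈⟨ +-identityˡ (- x) ⟩
    - x    ≤⟨ -x≤∣x∣ x ⟩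
    ∣ x ∣  ∎

  x≤y+∣x-y∣ : ∀ x y → x ≤ y + ∣ x - y ∣
  x≤y+∣x-y∣ x y = begin
    x              ≈⟨ x-y+y≈x x y ⟨
    x - y + y      ≤⟨ +-monoˡ-≤ y (x≤∣x∣ (x - y)) ⟩
    ∣ x - y ∣ + y  ≈⟨ +-comm ∣ x - y ∣ y ⟩
    y + ∣ x - y ∣  ∎

  y≤x+∣x-y∣ : ∀ x y → y ≤ x + ∣ x - y ∣
  y≤x+∣x-y∣ x y = begin
    y                     ≈⟨ +-identityʳ y ⟨
    y + 0#                ≈⟨ +-congˡ (-‿inverseʳ (x - y)) ⟨
    y + (x - y - (x - y)) ≈⟨ +-assoc y (x - y) (- (x - y)) ⟨
    y + (x - y) - (x - y) ≈⟨ +-congʳ (trans (+-comm y (x - y)) (x-y+y≈x x y)) ⟩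
    x - (x - y)           ≤⟨ +-monoʳ-≤ x (-x≤∣x∣ (x - y)) ⟩
    x + ∣ x - y ∣         ∎

  min≤ˡ : ∀ x y → min x y ≤ x
  min≤ˡ = Min.x⊓y≤x totalOrder

  min≤ʳ : ∀ x y → min x y ≤ y
  min≤ʳ = Min.x⊓y≤y totalOrder

  min-glb : ∀ {x y z} → x ≤ y → x ≤ z → x ≤ min y z
  min-glb = Min.⊓-glb totalOrder

  -- By totality `min x y` reduces to one of its arguments. This serves goals such as
  -- `u ≤ min s z + e`, where the minimum is not alone on the right and `min-glb` does not apply.
  min-elim : ∀ {p} (P : Carrier → Set p) {x y} → P x → P y → P (min x y)
  min-elim P {x} {y} px py with total x y
  ... | inj₁ _ = px
  ... | inj₂ _ = py

  sum-mono-≤ : ∀ {n} {f g : Vector Carrier n} → (∀ k → f k ≤ g k) → sum f ≤ sum g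
  sum-mono-≤ {ℕ.zero}  f≤g = ≤-refl
  sum-mono-≤ {ℕ.suc n} f≤g = +-mono-≤ (f≤g zero) (sum-mono-≤ (f≤g ∘ suc))

  sum-nonNegative : ∀ {n} {f : Vector Carrier n} → (∀ k → 0# ≤ f k) → 0# ≤ sum f
  sum-nonNegative {ℕ.zero}  0≤f = ≤-refl
  sum-nonNegative {ℕ.suc n} 0≤f = +-nonNegative (0≤f zero) (sum-nonNegative (0≤f ∘ suc))

  sum-≤-* : ∀ {n a} {f g : Vector Carrier n} → (∀ k → f k ≤ a * g k) → sum f ≤ a * sum g
  sum-≤-* {a = a} {g = g} f≤ag = ≤-trans (sum-mono-≤ f≤ag) (≤-reflexive (sym (*-distribˡ-sum a g)))

  sum-≤-+ : ∀ {n} {f g h : Vector Carrier n} → (∀ k → f k ≤ g k + h k) → sum f ≤ sum g + sum h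
  sum-≤-+ {g = g} {h} f≤g+h = ≤-trans (sum-mono-≤ f≤g+h) (≤-reflexive (∑-distrib-+ g h))

  fromℕ-+ : ∀ m n → fromℕ (m ℕ.+ n) ≈ fromℕ m + fromℕ n
  fromℕ-+ = ×-homo-+ 1#

  0≤fromℕ : ∀ n → 0# ≤ fromℕ n
  0≤fromℕ ℕ.zero    = ≤-refl
  0≤fromℕ (ℕ.suc n) = +-nonNegative 0≤1 (0≤fromℕ n)

  fromℕ-mono-≤ : ∀ {m n} → m ℕ.≤ n → fromℕ m ≤ fromℕ n
  fromℕ-mono-≤ {n = n} ℕ.z≤n = 0≤fromℕ n
  fromℕ-mono-≤ (ℕ.s≤s m≤n)   = +-monoʳ-≤ 1# (fromℕ-mono-≤ m≤n)

  fromℕ-positive : ∀ {n} → 0 ℕ.< n → 0# < fromℕ n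
  fromℕ-positive {n} 0<n = 0≤fromℕ n , λ 0≈n →
    1≰0 (≤-trans (≤-reflexive (sym (+-identityʳ 1#)))
                 (≤-trans (fromℕ-mono-≤ 0<n) (≤-reflexive (sym 0≈n))))

  min-fromℕ : ∀ m n → min (fromℕ m) (fromℕ n) ≤ fromℕ (m ℕ.⊓ n)
  min-fromℕ m n with ℕ.⊓-sel m n
  ... | inj₁ eq rewrite eq = min≤ˡ _ _
  ... | inj₂ eq rewrite eq = min≤ʳ _ _

  module Sumℕ = SemiringSum ℕ.+-*-semiring

  fromℕ-sum : ∀ {n} (f : Vector ℕ n) → fromℕ (Sumℕ.sum f) ≈ ∑[ k < n ] fromℕ (f k)
  fromℕ-sum {ℕ.zero}  f = refl
  fromℕ-sum {ℕ.suc n} f = trans (fromℕ-+ (f zero) _) (+-congˡ (fromℕ-sum (f ∘ suc)))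

-- Inequalities in the trust parameter.

module CompetitiveAnalysis {c ℓ₁ ℓ₂} (F : OrderedField c ℓ₁ ℓ₂) {θ : OrderedField.Carrier F}
  (0<θ : OrderedField._<_ F (OrderedField.0# F) θ) (θ<1 : OrderedField._<_ F θ (OrderedField.1# F)) where
  open OrderedField F
  open OrderedFieldProperties F

  ι δ δ⁻¹ : Carrier
  ι   = θ ⁻¹
  δ   = 1# - θ
  δ⁻¹ = δ ⁻¹

  0≤θ : 0# ≤ θ
  0≤θ = proj₁ 0<θ

  θ≤1 : θ ≤ 1#
  θ≤1 = proj₁ θ<1

  0<δ : 0# < δ
  0<δ = x≤y⇒0≤y-x θ≤1 , λ 0≈δ →
    proj₂ θ<1 (trans (sym (+-identityˡ θ)) (trans (+-congʳ 0≈δ) (x-y+y≈x 1# θ)))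

  0≤δ : 0# ≤ δ
  0≤δ = proj₁ 0<δ

  δ+θ≈1 : δ + θ ≈ 1#
  δ+θ≈1 = x-y+y≈x 1# θ

  δ≤1 : δ ≤ 1#
  δ≤1 = ≤-trans (x≤x+y 0≤θ) (≤-reflexive δ+θ≈1)

  0≤ι : 0# ≤ ι
  0≤ι = ⁻¹-nonNegative 0<θ

  0≤δ⁻¹ : 0# ≤ δ⁻¹
  0≤δ⁻¹ = ⁻¹-nonNegative 0<δ

  1≤ι : 1# ≤ ι
  1≤ι = 1≤x⁻¹ 0<θ θ≤1

  1≤δ⁻¹ : 1# ≤ δ⁻¹
  1≤δ⁻¹ = 1≤x⁻¹ 0<δ δ≤1

  0≤1+θ : 0# ≤ 1# + θ
  0≤1+θ = +-nonNegative 0≤1 0≤θ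

  0≤1+ι : 0# ≤ 1# + ι
  0≤1+ι = +-nonNegative 0≤1 0≤ι

  θ*ι*x≈x : ∀ x → θ * (ι * x) ≈ x
  θ*ι*x≈x x = trans (sym (*-assoc θ ι x)) (trans (*-congʳ (x*x⁻¹≈1 0<θ)) (*-identityˡ x))

  ι*θ*x≈x : ∀ x → ι * (θ * x) ≈ x
  ι*θ*x≈x x = trans (solve 3 (λ a b x → a :* (b :* x) := b :* (a :* x)) refl ι θ x) (θ*ι*x≈x x)

  [1+ι]*θ≈1+θ : ∀ x → (1# + ι) * (θ * x) ≈ (1# + θ) * x
  [1+ι]*θ≈1+θ x = trans
    (solve 3 (λ i t x → (con 1 :+ i) :* (t :* x) := t :* x :+ i :* (t :* x)) refl ι θ x)
    (trans (+-congˡ (ι*θ*x≈x x)) (solve 2 (λ t x → t :* x :+ x := (con 1 :+ t) :* x) refl θ x))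

  -- A purchase at the late threshold `s / θ` costs `s / θ + s`, which is `(1# + θ) * (s / θ)`.
  -- Purchases at either threshold thus cost `1# + θ` times a base amount, namely `s` or `s / θ`.
  [1+θ]*ι≈1+ι : ∀ x → (1# + θ) * (x / θ) ≈ (1# + ι) * x
  [1+θ]*ι≈1+ι x = trans
    (solve 3 (λ i t x → (con 1 :+ t) :* (x :* i) := i :* x :+ t :* (i :* x)) refl ι θ x)
    (trans (+-congˡ (θ*ι*x≈x x)) (solve 2 (λ t x → t :* x :+ x := (con 1 :+ t) :* x) refl ι x))

  -- Multiplying by `θ` gives `a ≤ θ * a + θ * e`, hence `δ * a ≤ θ * e`. A late threshold `a / θ`,
  -- reached although at most `a` was predicted, is therefore paid for by the error. This is where
  -- the factor `1 / (1 - θ)` comes from.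
  overshoot : ∀ {a e} → a / θ ≤ a + e → a ≤ θ * δ⁻¹ * e
  overshoot {a} {e} a/θ≤a+e = begin
    a                  ≈⟨ *-identityˡ a ⟨
    1# * a             ≈⟨ *-congʳ (x*x⁻¹≈1 0<δ) ⟨
    δ * δ⁻¹ * a        ≈⟨ solve 3 (λ d d′ a → d :* d′ :* a := d′ :* (d :* a)) refl δ δ⁻¹ a ⟩
    δ⁻¹ * (δ * a)      ≤⟨ *-monoʳ-≤ 0≤δ⁻¹ δ*a≤θ*e ⟩
    δ⁻¹ * (θ * e)      ≈⟨ solve 3 (λ t d′ e → d′ :* (t :* e) := t :* d′ :* e) refl θ δ⁻¹ e ⟩
    θ * δ⁻¹ * e        ∎
    where
    δ*a≤θ*e : δ * a ≤ θ * e
    δ*a≤θ*e = +-cancelʳ-≤ (θ * a) (begin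
      δ * a + θ * a   ≈⟨ distribʳ a δ θ ⟨
      (δ + θ) * a     ≈⟨ *-congʳ δ+θ≈1 ⟩
      1# * a          ≈⟨ *-identityˡ a ⟩
      a               ≈⟨ θ*ι*x≈x a ⟨
      θ * (ι * a)     ≈⟨ *-congˡ (*-comm ι a) ⟩
      θ * (a / θ)     ≤⟨ *-monoʳ-≤ 0≤θ a/θ≤a+e ⟩
      θ * (a + e)     ≈⟨ solve 3 (λ t a e → t :* (a :+ e) := t :* e :+ t :* a) refl θ a e ⟩
      θ * e + θ * a   ∎)

  e≤δ⁻¹*e : ∀ {e} → 0# ≤ e → e ≤ δ⁻¹ * e
  e≤δ⁻¹*e 0≤e = 1≤y⇒x≤y*x 0≤e 1≤δ⁻¹

  overshoot/θ : ∀ {a e} → a / θ ≤ a + e → a / θ ≤ δ⁻¹ * e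
  overshoot/θ {a} {e} a/θ≤a+e = begin
    a / θ                 ≈⟨ *-comm a ι ⟩
    ι * a                 ≤⟨ *-monoʳ-≤ 0≤ι (overshoot a/θ≤a+e) ⟩
    ι * (θ * δ⁻¹ * e)     ≈⟨ *-congˡ (*-assoc θ δ⁻¹ e) ⟩
    ι * (θ * (δ⁻¹ * e))   ≈⟨ ι*θ*x≈x (δ⁻¹ * e) ⟩
    δ⁻¹ * e               ∎

  -- The run of the algorithm seen from one item with single price s: predicted demand y,
  -- true demand z, uncovered demand ψ, threshold λₛ.  Its cost is charged against its
  -- contribution to the combo counter at the last rental or single purchase.
  record Item (s y z ψ λₛ cost charge : Carrier) : Set (c ⊔ ℓ₁ ⊔ ℓ₂) where
    field
      0≤s       : 0# ≤ s
      0≤z       : 0# ≤ z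
      ψ≤z       : ψ ≤ z
      0≤cost    : 0# ≤ cost
      0≤charge  : 0# ≤ charge
      threshold : s ≤ y × λₛ ≈ θ * s ⊎ y ≤ s × λₛ ≈ s / θ
      status    : (cost ≤ charge × charge ≤ ψ × charge ≤ λₛ)
                ⊎ (cost ≤ λₛ + s × λₛ ≤ ψ × λₛ ≤ charge)

  -- Cost and counter bounds for a single item.

  module _ {s y z ψ λₛ cost charge} (item : Item s y z ψ λₛ cost charge) where
    open Item item

    e : Carrier
    e = ∣ y - z ∣

    0≤e : 0# ≤ e
    0≤e = 0≤∣x∣ (y - z)

    s≤s/θ : s ≤ s / θ
    s≤s/θ = ≤-trans (1≤y⇒x≤y*x 0≤s 1≤ι) (≤-reflexive (*-comm ι s))

    θ*s≤s : θ * s ≤ s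
    θ*s≤s = y≤1⇒y*x≤x 0≤s θ≤1

    1≤1+ι : 1# ≤ 1# + ι
    1≤1+ι = x≤x+y 0≤ι

    λₛ≤ι*s : λₛ ≤ ι * s
    λₛ≤ι*s with threshold
    ... | inj₁ (_ , λₛ≈θ*s) = ≤-trans (≤-reflexive λₛ≈θ*s) (≤-trans θ*s≤s (1≤y⇒x≤y*x 0≤s 1≤ι))
    ... | inj₂ (_ , λₛ≈s/θ) = ≤-reflexive (trans λₛ≈s/θ (*-comm s ι))

    s≤ι*λₛ : s ≤ ι * λₛ
    s≤ι*λₛ with threshold
    ... | inj₁ (_ , λₛ≈θ*s) = ≤-reflexive (sym (trans (*-congˡ λₛ≈θ*s) (ι*θ*x≈x s)))
    ... | inj₂ (_ , λₛ≈s/θ) = begin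
      s           ≤⟨ s≤s/θ ⟩
      s / θ       ≤⟨ 1≤y⇒x≤y*x (≤-trans 0≤s s≤s/θ) 1≤ι ⟩
      ι * (s / θ) ≈⟨ *-congˡ λₛ≈s/θ ⟨
      ι * λₛ      ∎

    -- Only a purchase can cost more than the charge. It adds `s`, and `s ≤ ι * λₛ` under either
    -- threshold.
    cost≤[1+ι]*charge : cost ≤ (1# + ι) * charge
    cost≤[1+ι]*charge with status
    ... | inj₁ (cost≤charge , _) = ≤-trans cost≤charge (1≤y⇒x≤y*x 0≤charge 1≤1+ι)
    ... | inj₂ (cost≤λₛ+s , _ , λₛ≤charge) = begin
      cost              ≤⟨ cost≤λₛ+s ⟩
      λₛ + s            ≤⟨ +-monoʳ-≤ λₛ s≤ι*λₛ ⟩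
      λₛ + ι * λₛ       ≈⟨ solve 2 (λ i x → x :+ i :* x := (con 1 :+ i) :* x) refl ι λₛ ⟩
      (1# + ι) * λₛ     ≤⟨ *-monoʳ-≤ 0≤1+ι λₛ≤charge ⟩
      (1# + ι) * charge ∎

    λₛ+s≈[1+θ]*s : λₛ ≈ θ * s → λₛ + s ≈ (1# + θ) * s
    λₛ+s≈[1+θ]*s λₛ≈θ*s =
      trans (+-congʳ λₛ≈θ*s) (solve 2 (λ t x → t :* x :+ x := (con 1 :+ t) :* x) refl θ s)

    λₛ+s≈[1+ι]*s : λₛ ≈ s / θ → λₛ + s ≈ (1# + ι) * s
    λₛ+s≈[1+ι]*s λₛ≈s/θ =
      trans (+-congʳ λₛ≈s/θ) (solve 2 (λ i x → x :* i :+ x := (con 1 :+ i) :* x) refl ι s)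

    -- An item that was only rented costs at most `λₛ ≤ ι * s` and at most `ψ ≤ z`. After an early
    -- purchase the cost is at most `(1# + ι) * (θ * s)`, and `θ * s` lies below both `s` and `z`
    -- because `ψ` reached it. After a late purchase `z ≥ s / θ ≥ s`, so the minimum is `s`.
    cost≤[1+ι]*min : cost ≤ (1# + ι) * min s z
    cost≤[1+ι]*min with status | threshold
    ... | inj₁ (cost≤charge , charge≤ψ , charge≤λₛ) | _ = min-elim (λ m → cost ≤ (1# + ι) * m)
      (begin
        cost         ≤⟨ ≤-trans cost≤charge charge≤λₛ ⟩
        λₛ           ≤⟨ λₛ≤ι*s ⟩
        ι * s        ≤⟨ *-monoˡ-≤ 0≤s (≤-trans (x≤x+y 0≤1) (≤-reflexive (+-comm ι 1#))) ⟩
        (1# + ι) * s ∎)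
      (≤-trans (≤-trans cost≤charge (≤-trans charge≤ψ ψ≤z)) (1≤y⇒x≤y*x 0≤z 1≤1+ι))
    ... | inj₂ (cost≤λₛ+s , λₛ≤ψ , _) | inj₁ (_ , λₛ≈θ*s) = begin
      cost                 ≤⟨ cost≤λₛ+s ⟩
      λₛ + s               ≈⟨ λₛ+s≈[1+θ]*s λₛ≈θ*s ⟩
      (1# + θ) * s         ≈⟨ [1+ι]*θ≈1+θ s ⟨
      (1# + ι) * (θ * s)   ≤⟨ *-monoʳ-≤ 0≤1+ι
                                (min-glb θ*s≤s (≤-trans (≤-reflexive (sym λₛ≈θ*s)) (≤-trans λₛ≤ψ ψ≤z))) ⟩
      (1# + ι) * min s z   ∎
    ... | inj₂ (cost≤λₛ+s , λₛ≤ψ , _) | inj₂ (_ , λₛ≈s/θ) = begin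
      cost                 ≤⟨ cost≤λₛ+s ⟩
      λₛ + s               ≈⟨ λₛ+s≈[1+ι]*s λₛ≈s/θ ⟩
      (1# + ι) * s         ≤⟨ *-monoʳ-≤ 0≤1+ι (min-glb ≤-refl (≤-trans s≤s/θ
                                (≤-trans (≤-reflexive (sym λₛ≈s/θ)) (≤-trans λₛ≤ψ ψ≤z)))) ⟩
      (1# + ι) * min s z   ∎

    z≤y+e : z ≤ y + e
    z≤y+e = y≤x+∣x-y∣ y z

    y≤z+e : y ≤ z + e
    y≤z+e = x≤y+∣x-y∣ y z

    min-y≤min-z+e : min s y ≤ min s z + e
    min-y≤min-z+e = min-elim (λ m → min s y ≤ m + e)
      (≤-trans (min≤ˡ s y) (x≤x+y 0≤e)) (≤-trans (min≤ʳ s y) y≤z+e)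

    -- The early threshold is itself below `s`. The late one is chosen only when `y ≤ s`, and then
    -- `z` exceeds `s` by at most the error.
    ≤z∧≤λₛ⇒≤s+e : ∀ {u} → u ≤ z → u ≤ λₛ → u ≤ s + e
    ≤z∧≤λₛ⇒≤s+e u≤z u≤λₛ with threshold
    ... | inj₁ (_ , λₛ≈θ*s) =
      ≤-trans (≤-trans u≤λₛ (≤-reflexive λₛ≈θ*s)) (≤-trans θ*s≤s (x≤x+y 0≤e))
    ... | inj₂ (y≤s , _)    = ≤-trans (≤-trans u≤z z≤y+e) (+-monoˡ-≤ e y≤s)

    ≤z∧≤λₛ⇒≤min-y+e : ∀ {u} → u ≤ z → u ≤ λₛ → u ≤ min s y + e
    ≤z∧≤λₛ⇒≤min-y+e {u} u≤z u≤λₛ =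
      min-elim (λ m → u ≤ m + e) (≤z∧≤λₛ⇒≤s+e u≤z u≤λₛ) (≤-trans u≤z z≤y+e)

    min-ψ≤ι*min-z : min ψ λₛ ≤ ι * min s z
    min-ψ≤ι*min-z = min-elim (λ m → min ψ λₛ ≤ ι * m)
      (≤-trans (min≤ʳ ψ λₛ) λₛ≤ι*s)
      (≤-trans (min≤ˡ ψ λₛ) (≤-trans ψ≤z (1≤y⇒x≤y*x 0≤z 1≤ι)))

    min-ψ≤min-y+e : min ψ λₛ ≤ min s y + e
    min-ψ≤min-y+e = ≤z∧≤λₛ⇒≤min-y+e (≤-trans (min≤ˡ ψ λₛ) ψ≤z) (min≤ʳ ψ λₛ)

    -- The witness is the cost itself if the item was only rented, `s` after an early purchase and
    -- `s / θ` after a late one. The two upper bounds on `w` serve the two lower bounds on the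
    -- optimum: summed over the items they give `P + η` and `X + δ⁻¹ * η`.
    cost≤[1+θ]*w : Σ[ w ∈ Carrier ]
      (cost ≤ (1# + θ) * w × w ≤ min s y + e × w ≤ min s z + δ⁻¹ * e)
    cost≤[1+θ]*w with status | threshold
    ... | inj₁ (cost≤charge , charge≤ψ , charge≤λₛ) | _ =
      cost , 1≤y⇒x≤y*x 0≤cost (x≤x+y 0≤θ) , ≤z∧≤λₛ⇒≤min-y+e cost≤z cost≤λₛ ,
      ≤-trans (min-elim (λ m → cost ≤ m + e) (≤z∧≤λₛ⇒≤s+e cost≤z cost≤λₛ) (≤-trans cost≤z (x≤x+y 0≤e)))
              (+-monoʳ-≤ (min s z) (e≤δ⁻¹*e 0≤e))
      where
      cost≤z : cost ≤ z
      cost≤z = ≤-trans cost≤charge (≤-trans charge≤ψ ψ≤z)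
      cost≤λₛ : cost ≤ λₛ
      cost≤λₛ = ≤-trans cost≤charge charge≤λₛ
    ... | inj₂ (cost≤λₛ+s , _) | inj₁ (s≤y , λₛ≈θ*s) =
      s , ≤-trans cost≤λₛ+s (≤-reflexive (λₛ+s≈[1+θ]*s λₛ≈θ*s)) ,
      ≤-trans s≤min-y (x≤x+y 0≤e) ,
      ≤-trans s≤min-y (≤-trans min-y≤min-z+e (+-monoʳ-≤ (min s z) (e≤δ⁻¹*e 0≤e)))
      where
      s≤min-y : s ≤ min s y
      s≤min-y = min-glb ≤-refl s≤y
    ... | inj₂ (cost≤λₛ+s , λₛ≤ψ , _) | inj₂ (_ , λₛ≈s/θ) =
      s / θ , ≤-trans cost≤λₛ+s (≤-reflexive (trans (λₛ+s≈[1+ι]*s λₛ≈s/θ) (sym ([1+θ]*ι≈1+ι s)))) ,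
      ≤z∧≤λₛ⇒≤min-y+e s/θ≤z s/θ≤λₛ ,
      (begin
        -- The demand reached `s / θ` against a prediction of at most `s`, so the error alone pays
        -- for `s / θ`. The minimum is added only to match the stated form.
        s / θ                   ≤⟨ overshoot/θ (≤z∧≤λₛ⇒≤s+e s/θ≤z s/θ≤λₛ) ⟩
        δ⁻¹ * e                 ≤⟨ x≤x+y (min-elim (0# ≤_) 0≤s 0≤z) ⟩
        δ⁻¹ * e + min s z       ≈⟨ +-comm (δ⁻¹ * e) (min s z) ⟩
        min s z + δ⁻¹ * e       ∎)
      where
      s/θ≤λₛ : s / θ ≤ λₛ
      s/θ≤λₛ = ≤-reflexive (sym λₛ≈s/θ)
      s/θ≤z : s / θ ≤ z
      s/θ≤z = ≤-trans s/θ≤λₛ (≤-trans λₛ≤ψ ψ≤z)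

  -- v stands for the offline optimum.
  record Outcome {K} (s C λ꜀ comboCost v : Carrier) (y z ψ λₛ cost charge : Vector Carrier K)
    : Set (c ⊔ ℓ₁ ⊔ ℓ₂) where
    field
      items      : ∀ k → Item s (y k) (z k) (ψ k) (λₛ k) (cost k) (charge k)
      0≤C        : 0# ≤ C
      threshold꜀ : C ≤ ∑[ k < K ] min s (y k) × λ꜀ ≈ θ ^ 2 * C
                 ⊎ ∑[ k < K ] min s (y k) ≤ C × λ꜀ ≈ C / θ
      charge≤λ꜀  : sum charge ≤ λ꜀
      combo      : comboCost ≤ 0# ⊎ (comboCost ≤ C × λ꜀ ≤ ∑[ k < K ] min (ψ k) (λₛ k))
      lowerBound : C ≤ v ⊎ ∑[ k < K ] min s (z k) ≤ v

  -- Summation over the items: the robustness and smoothness bounds.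

  module _ {K} {s C λ꜀ comboCost v : Carrier} {y z ψ λₛ cost charge : Vector Carrier K}
    (outcome : Outcome s C λ꜀ comboCost v y z ψ λₛ cost charge) where
    open Outcome outcome

    X P η : Carrier
    X = ∑[ k < K ] min s (z k)
    P = ∑[ k < K ] min s (y k)
    η = ∑[ k < K ] ∣ y k - z k ∣

    0≤X : 0# ≤ X
    0≤X = sum-nonNegative (λ k → min-elim (0# ≤_) (Item.0≤s (items k)) (Item.0≤z (items k)))

    0≤η : 0# ≤ η
    0≤η = sum-nonNegative (λ k → 0≤∣x∣ (y k - z k))

    0≤v : 0# ≤ v
    0≤v = [ ≤-trans 0≤C , ≤-trans 0≤X ]′ lowerBound

    comboCost≤C : comboCost ≤ C
    comboCost≤C = [ (λ ≤0 → ≤-trans ≤0 0≤C) , proj₁ ]′ combo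

    sum-cost≤[1+ι]*λ꜀ : sum cost ≤ (1# + ι) * λ꜀
    sum-cost≤[1+ι]*λ꜀ =
      ≤-trans (sum-≤-* (λ k → cost≤[1+ι]*charge (items k))) (*-monoʳ-≤ 0≤1+ι charge≤λ꜀)

    θ^2*x≈θ*θ*x : ∀ x → θ ^ 2 * x ≈ θ * (θ * x)
    θ^2*x≈θ*θ*x = solve 2 (λ t x → t :^ 2 :* x := t :* (t :* x)) refl θ

    θ^2*C≤C : θ ^ 2 * C ≤ C
    θ^2*C≤C = begin
      θ ^ 2 * C     ≈⟨ θ^2*x≈θ*θ*x C ⟩
      θ * (θ * C)   ≤⟨ y≤1⇒y*x≤x (*-nonNegative 0≤θ 0≤C) θ≤1 ⟩
      θ * C         ≤⟨ y≤1⇒y*x≤x 0≤C θ≤1 ⟩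
      C             ∎

    C≤ι*C : C ≤ ι * C
    C≤ι*C = 1≤y⇒x≤y*x 0≤C 1≤ι

    λ꜀≤ι*C : λ꜀ ≤ ι * C
    λ꜀≤ι*C with threshold꜀
    ... | inj₁ (_ , λ꜀≈θ^2*C) = ≤-trans (≤-reflexive λ꜀≈θ^2*C) (≤-trans θ^2*C≤C C≤ι*C)
    ... | inj₂ (_ , λ꜀≈C/θ)   = ≤-reflexive (trans λ꜀≈C/θ (*-comm C ι))

    θ^2*C≤λ꜀ : θ ^ 2 * C ≤ λ꜀
    θ^2*C≤λ꜀ with threshold꜀
    ... | inj₁ (_ , λ꜀≈θ^2*C) = ≤-reflexive (sym λ꜀≈θ^2*C)
    ... | inj₂ (_ , λ꜀≈C/θ)   =
      ≤-trans θ^2*C≤C (≤-trans C≤ι*C (≤-reflexive (trans (*-comm ι C) (sym λ꜀≈C/θ))))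

    0≤ι^3 : 0# ≤ ι ^ 3
    0≤ι^3 = *-nonNegative 0≤ι (*-nonNegative 0≤ι (*-nonNegative 0≤ι 0≤1))

    -- Two factors `ι` undo the smallest combo threshold `θ ^ 2 * C`. The third arises because a
    -- counter may grow to `s / θ`, so the combo counter can reach `ι * X`.
    comboCost≤ι^3*X : comboCost ≤ ι ^ 3 * X
    comboCost≤ι^3*X with combo
    ... | inj₁ comboCost≤0 =
      ≤-trans comboCost≤0 (*-nonNegative 0≤ι^3 0≤X)
    ... | inj₂ (comboCost≤C′ , λ꜀≤ψ꜀) = begin
      comboCost                       ≤⟨ comboCost≤C′ ⟩
      C                               ≈⟨ trans (*-congˡ (ι*θ*x≈x (θ * C))) (ι*θ*x≈x C) ⟨
      ι * (ι * (θ * (θ * C)))         ≈⟨ *-congˡ (*-congˡ (θ^2*x≈θ*θ*x C)) ⟨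
      ι * (ι * (θ ^ 2 * C))           ≤⟨ *-monoʳ-≤ 0≤ι (*-monoʳ-≤ 0≤ι (≤-trans θ^2*C≤λ꜀ (≤-trans λ꜀≤ψ꜀
                                           (sum-≤-* (λ k → min-ψ≤ι*min-z (items k)))))) ⟩
      ι * (ι * (ι * X))               ≈⟨ solve 2 (λ i x → i :* (i :* (i :* x)) := i :^ 3 :* x) refl ι X ⟩
      ι ^ 3 * X                       ∎

    robust-bound : sum cost + comboCost ≤ (1# + ι + ι ^ 3) * v
    robust-bound with lowerBound
    ... | inj₁ C≤v = begin
      sum cost + comboCost              ≤⟨ +-mono-≤ (≤-trans sum-cost≤[1+ι]*λ꜀ (*-monoʳ-≤ 0≤1+ι λ꜀≤ι*C))
                                             comboCost≤C ⟩
      (1# + ι) * (ι * C) + C            ≈⟨ solve 2 (λ i C → (con 1 :+ i) :* (i :* C) :+ C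
                                             := (C :+ i :* C) :+ i :* (i :* C)) refl ι C ⟩
      -- This branch yields the smaller ratio `1# + ι + ι ^ 2`. One more factor `ι` brings it to the
      -- ratio of the other branch.
      (C + ι * C) + ι * (ι * C)         ≤⟨ +-monoʳ-≤ _ (*-monoʳ-≤ 0≤ι (*-monoʳ-≤ 0≤ι C≤ι*C)) ⟩
      (C + ι * C) + ι * (ι * (ι * C))   ≈⟨ solve 2 (λ i C → (C :+ i :* C) :+ i :* (i :* (i :* C))
                                             := (con 1 :+ i :+ i :^ 3) :* C) refl ι C ⟩
      (1# + ι + ι ^ 3) * C              ≤⟨ *-monoʳ-≤ (+-nonNegative 0≤1+ι 0≤ι^3) C≤v ⟩
      (1# + ι + ι ^ 3) * v              ∎
    ... | inj₂ X≤v = begin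
      sum cost + comboCost        ≤⟨ +-mono-≤ (sum-≤-* (λ k → cost≤[1+ι]*min (items k))) comboCost≤ι^3*X ⟩
      (1# + ι) * X + ι ^ 3 * X    ≈⟨ distribʳ X (1# + ι) (ι ^ 3) ⟨
      (1# + ι + ι ^ 3) * X        ≤⟨ *-monoʳ-≤ (+-nonNegative 0≤1+ι 0≤ι^3) X≤v ⟩
      (1# + ι + ι ^ 3) * v        ∎

    κ : Carrier
    κ = (1# + fromℕ 2 * θ) / δ

    0≤θ*x : ∀ {x} → 0# ≤ x → 0# ≤ θ * x
    0≤θ*x = *-nonNegative 0≤θ

    0≤β : 0# ≤ 1# + θ + θ ^ 2
    0≤β = +-nonNegative 0≤1+θ (0≤θ*x (0≤θ*x 0≤1))

    -- After multiplication by `δ`, the terms `δ`, `θ * δ` and `θ ^ 2 * δ` are at most `1#`, `θ` and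
    -- `θ`. The estimate is used when `C` is known only to be at most `v + η`: the error then
    -- carries the factor `1# + θ + θ ^ 2`, which has to fit under `κ`.
    β≤κ : 1# + θ + θ ^ 2 ≤ κ
    β≤κ = begin
      1# + θ + θ ^ 2                    ≈⟨ *-identityʳ _ ⟨
      (1# + θ + θ ^ 2) * 1#             ≈⟨ *-congˡ (x*x⁻¹≈1 0<δ) ⟨
      (1# + θ + θ ^ 2) * (δ * δ⁻¹)      ≈⟨ solve 3 (λ t d d′ → (con 1 :+ t :+ t :^ 2) :* (d :* d′)
                                             := (d :+ (t :* d :+ t :* (t :* d))) :* d′) refl θ δ δ⁻¹ ⟩
      (δ + (θ * δ + θ * (θ * δ))) * δ⁻¹ ≤⟨ *-monoˡ-≤ 0≤δ⁻¹ (+-mono-≤ δ≤1 (+-mono-≤ θ*δ≤θ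
                                             (*-monoʳ-≤ 0≤θ (≤-trans θ*δ≤θ θ≤1)))) ⟩
      -- The solver term `con 1 :+ (con 1 :+ con 0)` mirrors the unfolding of `fromℕ 2`.
      (1# + (θ + θ * 1#)) * δ⁻¹         ≈⟨ solve 2 (λ t d′ → (con 1 :+ (t :+ t :* con 1)) :* d′
                                             := (con 1 :+ (con 1 :+ (con 1 :+ con 0)) :* t) :* d′) refl θ δ⁻¹ ⟩
      κ                                 ∎
      where
      θ*δ≤θ : θ * δ ≤ θ
      θ*δ≤θ = ≤-trans (*-monoʳ-≤ 0≤θ δ≤1) (≤-reflexive (*-identityʳ θ))

    0≤κ*η : 0# ≤ κ * η
    0≤κ*η = *-nonNegative (≤-trans 0≤β β≤κ) 0≤η

    β*v+κ*η-bound : C ≤ v ⊎ C ≤ v + η → (1# + θ + θ ^ 2) * C ≤ (1# + θ + θ ^ 2) * v + κ * η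
    β*v+κ*η-bound (inj₁ C≤v)   = ≤-trans (*-monoʳ-≤ 0≤β C≤v) (x≤x+y 0≤κ*η)
    β*v+κ*η-bound (inj₂ C≤v+η) = begin
      (1# + θ + θ ^ 2) * C                          ≤⟨ *-monoʳ-≤ 0≤β C≤v+η ⟩
      (1# + θ + θ ^ 2) * (v + η)                    ≈⟨ distribˡ _ v η ⟩
      (1# + θ + θ ^ 2) * v + (1# + θ + θ ^ 2) * η   ≤⟨ +-monoʳ-≤ _ (*-monoˡ-≤ 0≤η β≤κ) ⟩
      (1# + θ + θ ^ 2) * v + κ * η                  ∎

    δ⁻¹*η≈sum : δ⁻¹ * η ≈ ∑[ k < K ] (δ⁻¹ * ∣ y k - z k ∣)
    δ⁻¹*η≈sum = *-distribˡ-sum δ⁻¹ (λ k → ∣ y k - z k ∣)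

    -- If `C ≤ v`, the witnesses sum to at most `P + η ≤ v + η`. If `X ≤ v`, their comparison with
    -- the true demands gives `X + δ⁻¹ * η` instead.
    sum-cost≤[1+θ]*[v+δ⁻¹*η] : P ≤ C → sum cost ≤ (1# + θ) * (v + δ⁻¹ * η)
    sum-cost≤[1+θ]*[v+δ⁻¹*η] P≤C = ≤-trans
      (sum-≤-* (λ k → proj₁ (proj₂ (cost≤[1+θ]*w (items k)))))
      (*-monoʳ-≤ 0≤1+θ sum-w≤)
      where
      w : Vector Carrier K
      w k = proj₁ (cost≤[1+θ]*w (items k))
      sum-w≤ : sum w ≤ v + δ⁻¹ * η
      sum-w≤ with lowerBound
      ... | inj₁ C≤v = begin
        sum w         ≤⟨ sum-≤-+ (λ k → proj₁ (proj₂ (proj₂ (cost≤[1+θ]*w (items k))))) ⟩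
        P + η         ≤⟨ +-mono-≤ (≤-trans P≤C C≤v) (e≤δ⁻¹*e 0≤η) ⟩
        v + δ⁻¹ * η   ∎
      ... | inj₂ X≤v = begin
        sum w         ≤⟨ sum-≤-+ (λ k → proj₂ (proj₂ (proj₂ (cost≤[1+θ]*w (items k))))) ⟩
        X + _         ≤⟨ +-mono-≤ X≤v (≤-reflexive (sym δ⁻¹*η≈sum)) ⟩
        v + δ⁻¹ * η   ∎

    comboCost≤θ*δ⁻¹*η : P ≤ C → λ꜀ ≈ C / θ → comboCost ≤ θ * δ⁻¹ * η
    comboCost≤θ*δ⁻¹*η P≤C λ꜀≈C/θ with combo
    ... | inj₁ comboCost≤0 = ≤-trans comboCost≤0 (*-nonNegative (0≤θ*x 0≤δ⁻¹) 0≤η)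
    ... | inj₂ (comboCost≤C′ , λ꜀≤ψ꜀) = ≤-trans comboCost≤C′ (overshoot (begin
      C / θ                           ≈⟨ λ꜀≈C/θ ⟨
      λ꜀                              ≤⟨ λ꜀≤ψ꜀ ⟩
      ∑[ k < K ] min (ψ k) (λₛ k)     ≤⟨ sum-≤-+ (λ k → min-ψ≤min-y+e (items k)) ⟩
      P + η                           ≤⟨ +-monoˡ-≤ η P≤C ⟩
      C + η                           ∎))

    smooth-bound : sum cost + comboCost ≤ (1# + θ + θ ^ 2) * v + κ * η
    smooth-bound with threshold꜀
    ... | inj₁ (C≤P , λ꜀≈θ^2*C) = begin
      sum cost + comboCost                  ≤⟨ +-mono-≤ sum-cost≤[1+ι]*λ꜀ comboCost≤C ⟩
      (1# + ι) * λ꜀ + C                     ≈⟨ +-congʳ (*-congˡ (trans λ꜀≈θ^2*C (θ^2*x≈θ*θ*x C))) ⟩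
      -- One `θ` of the threshold `θ ^ 2 * C` cancels the `ι` of the charging bound. The items then
      -- cost at most `θ * C + θ ^ 2 * C`, and the combo adds `C`.
      (1# + ι) * (θ * (θ * C)) + C          ≈⟨ +-congʳ ([1+ι]*θ≈1+θ (θ * C)) ⟩
      (1# + θ) * (θ * C) + C                ≈⟨ solve 2 (λ t C → (con 1 :+ t) :* (t :* C) :+ C
                                                 := (con 1 :+ t :+ t :^ 2) :* C) refl θ C ⟩
      (1# + θ + θ ^ 2) * C                  ≤⟨ β*v+κ*η-bound C≤v⊎C≤v+η ⟩
      (1# + θ + θ ^ 2) * v + κ * η          ∎
      where
      C≤v⊎C≤v+η : C ≤ v ⊎ C ≤ v + η
      C≤v⊎C≤v+η with lowerBound
      ... | inj₁ C≤v = inj₁ C≤v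
      ... | inj₂ X≤v = inj₂ (≤-trans C≤P (≤-trans
        (sum-≤-+ (λ k → min-y≤min-z+e (items k))) (+-monoˡ-≤ η X≤v)))
    ... | inj₂ (P≤C , λ꜀≈C/θ) = begin
      sum cost + comboCost
        ≤⟨ +-mono-≤ (sum-cost≤[1+θ]*[v+δ⁻¹*η] P≤C) (comboCost≤θ*δ⁻¹*η P≤C λ꜀≈C/θ) ⟩
      (1# + θ) * (v + δ⁻¹ * η) + θ * δ⁻¹ * η
        -- The error factors `(1# + θ) * δ⁻¹` of the items and `θ * δ⁻¹` of the combo add up to `κ`.
        ≈⟨ solve 4 (λ t d′ v η → (con 1 :+ t) :* (v :+ d′ :* η) :+ t :* d′ :* η
             := (con 1 :+ t) :* v :+ (con 1 :+ (con 1 :+ (con 1 :+ con 0)) :* t) :* d′ :* η) refl θ δ⁻¹ v η ⟩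
      (1# + θ) * v + κ * η
        ≤⟨ +-monoˡ-≤ (κ * η) (*-monoˡ-≤ 0≤v (x≤x+y (0≤θ*x (0≤θ*x 0≤1)))) ⟩
      (1# + θ + θ ^ 2) * v + κ * η
        ∎

-- Lower bounds on the cost of an offline solution.

module OfflineBound (I : Instance) where
  open Instance I
  open SkiRental I
  open SemiringSum ℕ.+-*-semiring using
    (sum; sum-syntax; sum-cong-≗; sum-replicate-zero; ∑-comm; ∑-distrib-+; *-distribʳ-sum)

  sum-mono-≤ : ∀ {n} {f g : Vector ℕ n} → (∀ k → f k ℕ.≤ g k) → sum f ℕ.≤ sum g
  sum-mono-≤ {ℕ.zero}  f≤g = ℕ.z≤n
  sum-mono-≤ {ℕ.suc n} f≤g = ℕ.+-mono-≤ (f≤g zero) (sum-mono-≤ (f≤g ∘ suc))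

  sum-indicator : ∀ {n} (i : Fin n) a → ∑[ k < n ] (𝟙 (does (i Fin.≟ k)) ℕ.* a) ≡ a
  sum-indicator {ℕ.suc n} zero    a =
    ≡.trans (≡.cong₂ ℕ._+_ (ℕ.*-identityˡ a) (sum-replicate-zero n)) (ℕ.+-identityʳ a)
  sum-indicator {ℕ.suc n} (suc i) a = sum-indicator i a

  sum-amountFor : ∀ d → ∑[ k < K ] amountFor k d ≡ amount d
  sum-amountFor (just (i , a)) = sum-indicator i a
  sum-amountFor nothing        = sum-replicate-zero K

  madeBy-mono : ∀ τ {t T} → t ℕ.≤ T → madeBy τ T ≡ false → madeBy τ t ≡ false
  madeBy-mono nothing  t≤T _ = ≡.refl
  madeBy-mono (just s) {t} {T} t≤T s≮T with s ℕ.<ᵇ t in s<ᵇt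
  ... | false = ≡.refl
  ... | true  = contradiction (≡.subst Bool.T s≮T (ℕ.<⇒<ᵇ (ℕ.<-≤-trans s<t t≤T))) λ ()
    where
    s<t : s ℕ.< t
    s<t = ℕ.<ᵇ⇒< s t (≡.subst Bool.T (≡.sym s<ᵇt) _)

  module _ {T} (D : Demands T) (S : Solution T) (feasible : Feasible D S) where
    open Solution S

    rentFor : Fin K → ℕ
    rentFor k = ∑[ j < T ] (amountFor k (D j) ℕ.* 𝟙 (rent j))

    -- After exchanging the sums, the amounts for all items in one slot add up to the amount of that
    -- slot, since its demand concerns at most one item.
    sum-rentFor : ∑[ k < K ] rentFor k ≡ ∑[ j < T ] (amount (D j) ℕ.* 𝟙 (rent j))
    sum-rentFor = ≡.trans (∑-comm (λ k j → amountFor k (D j) ℕ.* 𝟙 (rent j)))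
      (sum-cong-≗ λ j → ≡.trans (≡.sym (*-distribʳ-sum (𝟙 (rent j)) (λ k → amountFor k (D j))))
                                (≡.cong (ℕ._* 𝟙 (rent j)) (sum-amountFor (D j))))

    amountFor≤rentFor : madeBy combo T ≡ false → ∀ k → madeBy (single k) T ≡ false →
      ∀ j → amountFor k (D j) ℕ.≤ amountFor k (D j) ℕ.* 𝟙 (rent j)
    amountFor≤rentFor noCombo k noSingle j with D j in Dj
    ... | nothing      = ℕ.z≤n
    ... | just (i , a) with i Fin.≟ k
    ...   | no _       = ℕ.z≤n
    ...   | yes ≡.refl with rent j | feasible j i a Dj
    ...     | true  | _ = ℕ.≤-reflexive (≡.sym (ℕ.*-identityʳ _))
    ...     | false | covered
      -- The slot of index `j` has time `suc (toℕ j)`, so `toℕ j < T` says exactly that this time is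
      -- at most `T`. No purchase by `T` then means none by this slot, and feasibility would force a
      -- rental.
      rewrite madeBy-mono (single k) (Fin.toℕ<n j) noSingle | madeBy-mono combo (Fin.toℕ<n j) noCombo
      = contradiction covered λ ()

    itemLowerBound : madeBy combo T ≡ false → ∀ k →
      Cₛ ℕ.⊓ totalDemand D k ℕ.≤ rentFor k ℕ.+ Cₛ ℕ.* 𝟙 (madeBy (single k) T)
    itemLowerBound noCombo k with madeBy (single k) T in made
    ... | true  = ℕ.≤-trans (ℕ.m⊓n≤m Cₛ _)
      (ℕ.≤-trans (ℕ.≤-reflexive (≡.sym (ℕ.*-identityʳ Cₛ))) (ℕ.m≤n+m (Cₛ ℕ.* 1) (rentFor k)))
    ... | false = ℕ.≤-trans (ℕ.m⊓n≤n Cₛ _)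
      (ℕ.≤-trans (sum-mono-≤ (amountFor≤rentFor noCombo k made)) (ℕ.m≤m+n (rentFor k) (Cₛ ℕ.* 0)))

    -- A combo made by the horizon costs `C꜀`. Otherwise each item separately pays either `Cₛ` or
    -- rent for its whole demand, and these payments add up.
    cost-lowerBound : C꜀ ℕ.≤ cost D S ⊎ ∑[ k < K ] (Cₛ ℕ.⊓ totalDemand D k) ℕ.≤ cost D S
    cost-lowerBound with madeBy combo T in made
    ... | true  = inj₁ (ℕ.≤-trans (ℕ.≤-reflexive (≡.sym (ℕ.*-identityʳ C꜀))) (ℕ.m≤n+m (C꜀ ℕ.* 1) _))
    ... | false = inj₂ (ℕ.≤-trans (sum-mono-≤ (itemLowerBound made))
      (ℕ.≤-trans (ℕ.≤-reflexive (≡.trans (∑-distrib-+ rentFor (λ k → Cₛ ℕ.* 𝟙 (madeBy (single k) T)))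
                                         (≡.cong (ℕ._+ _) sum-rentFor)))
                 (ℕ.m≤m+n _ (C꜀ ℕ.* 0))))

-- The online run and its invariant.

module Online {c ℓ₁ ℓ₂} (F : OrderedField c ℓ₁ ℓ₂) (I : Instance) {θ : OrderedField.Carrier F}
  (0<θ : OrderedField._<_ F (OrderedField.0# F) θ) (θ<1 : OrderedField._<_ F θ (OrderedField.1# F)) where
  open OrderedField F
  open Instance I
  open SkiRental I
  open LearningAugmented F I
  open OrderedFieldProperties F
  open CompetitiveAnalysis F 0<θ θ<1

  updateAt-elim : ∀ {n a p} {A : Set a} (Q : Fin n → A → Set p) i {f : A → A} {xs : Vector A n} →
    Q i (f (xs i)) → (∀ k → k ≢ i → Q k (xs k)) → ∀ k → Q k (updateAt xs i f k)
  updateAt-elim Q i {xs = xs} Qi Qk k with k Fin.≟ i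
  ... | yes ≡.refl = ≡.subst (Q k) (≡.sym (updateAt-updates i xs)) Qi
  ... | no k≢i     = ≡.subst (Q k) (≡.sym (updateAt-minimal k i xs k≢i)) (Qk k k≢i)

  sum-updateAt : ∀ {n} i a (xs : Vector ℕ n) → Sumℕ.sum (updateAt xs i (ℕ._+ a)) ≡ Sumℕ.sum xs ℕ.+ a
  sum-updateAt zero    a xs = ≡.trans (ℕ.+-assoc (head xs) a _)
    (≡.trans (≡.cong (head xs ℕ.+_) (ℕ.+-comm a _)) (≡.sym (ℕ.+-assoc (head xs) _ a)))
  sum-updateAt (suc i) a xs =
    ≡.trans (≡.cong (head xs ℕ.+_) (sum-updateAt i a (tail xs))) (≡.sym (ℕ.+-assoc (head xs) _ a))

  ≰⇒≥ : ∀ {x z} → ¬ x ≤ z → z ≤ x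
  ≰⇒≥ {x} {z} x≰z = [ (λ x≤z → contradiction x≤z x≰z) , (λ z≤x → z≤x) ]′ (total x z)

  module _ (y : Prediction) where
    λs : Vector Carrier K
    λs = λₛ θ y

    λc : Carrier
    λc = λ꜀ θ y

    counter : Vector ℕ K → Carrier
    counter ψ = ∑[ k < K ] min (fromℕ (ψ k)) (λs k)

    -- An item that was not purchased is charged its rent and not its counter. The demand that
    -- triggers the combo raises `ψ` without being rented, so charges read off `ψ` could sum to more
    -- than `λc`.
    charge : Vector ℕ K → Vector Time K → Vector Carrier K
    charge R single k = if is-just (single k) then λs k else fromℕ (R k)

    -- R k is the rent paid so far for item k.
    record Invariant (R : Vector ℕ K) (σ : State θ y) : Set (c ⊔ ℓ₁ ⊔ ℓ₂) where
      open State σ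
      field
        R≤ψ       : ∀ k → R k ℕ.≤ ψ k
        R≤λs      : ∀ k → fromℕ (R k) ≤ λs k
        purchased : ∀ k → is-just (single k) ≡ true → λs k ≤ fromℕ (ψ k)
        charge≤λc : sum (charge R single) ≤ λc
        combined  : is-just combo ≡ true → λc ≤ counter ψ

    threshold-single : ∀ k → fromℕ Cₛ ≤ y k × λs k ≈ θ * fromℕ Cₛ ⊎ y k ≤ fromℕ Cₛ × λs k ≈ fromℕ Cₛ / θ
    threshold-single k with fromℕ Cₛ ≤? y k
    ... | yes s≤y = inj₁ (s≤y , refl)
    ... | no  s≰y = inj₂ (≰⇒≥ s≰y , refl)

    threshold-combo : let P = ∑[ k < K ] min (fromℕ Cₛ) (y k) in
      fromℕ C꜀ ≤ P × λc ≈ θ ^ 2 * fromℕ C꜀ ⊎ P ≤ fromℕ C꜀ × λc ≈ fromℕ C꜀ / θ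
    threshold-combo with fromℕ C꜀ ≤? ∑[ k < K ] min (fromℕ Cₛ) (y k)
    ... | yes C≤P = inj₁ (C≤P , refl)
    ... | no  C≰P = inj₂ (≰⇒≥ C≰P , refl)

    0≤λs : ∀ k → 0# ≤ λs k
    0≤λs k with threshold-single k
    ... | inj₁ (_ , λs≈) = ≤-trans (*-nonNegative 0≤θ (0≤fromℕ Cₛ)) (≤-reflexive (sym λs≈))
    ... | inj₂ (_ , λs≈) = ≤-trans (*-nonNegative (0≤fromℕ Cₛ) 0≤ι) (≤-reflexive (sym λs≈))

    0≤λc : 0# ≤ λc
    0≤λc with threshold-combo
    ... | inj₁ (_ , λc≈) = ≤-trans
      (*-nonNegative (*-nonNegative 0≤θ (*-nonNegative 0≤θ 0≤1)) (0≤fromℕ C꜀)) (≤-reflexive (sym λc≈))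
    ... | inj₂ (_ , λc≈) = ≤-trans (*-nonNegative (0≤fromℕ C꜀) 0≤ι) (≤-reflexive (sym λc≈))

    initial-invariant : Invariant (λ _ → 0) (initial θ y)
    initial-invariant = record
      { R≤ψ       = λ k → ℕ.z≤n
      ; R≤λs      = 0≤λs
      ; purchased = λ k ()
      ; charge≤λc = ≤-trans (≤-reflexive (sum-replicate-zero K)) 0≤λc
      ; combined  = λ ()
      }
      where open SemiringSum semiring using (sum-replicate-zero)

    -- Each charge is at most the summand of its item in the combo counter. A step that rents or
    -- makes a single purchase has failed the combo test, so its updated counter is at most `λc`.
    below-counter : ∀ {R ψ single} → (∀ k → R k ℕ.≤ ψ k) → (∀ k → fromℕ (R k) ≤ λs k) →
      (∀ k → is-just (single k) ≡ true → λs k ≤ fromℕ (ψ k)) →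
      counter ψ ≤ λc → sum (charge R single) ≤ λc
    below-counter {R} {ψ} {single} R≤ψ R≤λs purchased ψ≤λc = ≤-trans (sum-mono-≤ charge≤) ψ≤λc
      where
      charge≤ : ∀ k → charge R single k ≤ min (fromℕ (ψ k)) (λs k)
      charge≤ k with is-just (single k) | purchased k
      ... | true  | λs≤ψ = min-glb (λs≤ψ ≡.refl) ≤-refl
      ... | false | _    = min-glb (fromℕ-mono-≤ (R≤ψ k)) (R≤λs k)

    ψ≤updateAt : ∀ i a (ψ : Vector ℕ K) k → ψ k ℕ.≤ updateAt ψ i (ℕ._+ a) k
    ψ≤updateAt i a ψ = updateAt-elim (λ k x → ψ k ℕ.≤ x) i (ℕ.m≤m+n (ψ i) a) (λ k _ → ℕ.≤-refl)

    updateAt≤ψ+amountFor : ∀ i a (ψ : Vector ℕ K) k →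
      updateAt ψ i (ℕ._+ a) k ℕ.≤ ψ k ℕ.+ amountFor k (just (i , a))
    updateAt≤ψ+amountFor i a ψ =
      updateAt-elim (λ k x → x ℕ.≤ ψ k ℕ.+ amountFor k (just (i , a))) i at-i (λ k _ → ℕ.m≤m+n (ψ k) _)
      where
      at-i : ψ i ℕ.+ a ℕ.≤ ψ i ℕ.+ amountFor i (just (i , a))
      at-i rewrite dec-true (i Fin.≟ i) ≡.refl = ℕ.≤-reflexive (≡.cong (ψ i ℕ.+_) (≡.sym (ℕ.*-identityˡ a)))

    m≡m+n*0 : ∀ m n → m ≡ m ℕ.+ n ℕ.* 0
    m≡m+n*0 m n = ≡.sym (≡.trans (≡.cong (m ℕ.+_) (ℕ.*-zeroʳ n)) (ℕ.+-identityʳ m))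

    -- The witness is `R` itself unless the slot is rented, when the amount is added at `i`. The
    -- last component, summed over the run, bounds the uncovered demand by the total demand.
    step-invariant : ∀ s d {R σ} → Invariant R σ → let r , σ′ = step θ y s d σ in
      Σ[ R′ ∈ Vector ℕ K ] (Invariant R′ σ′
        × Sumℕ.sum R′ ≡ Sumℕ.sum R ℕ.+ amount d ℕ.* 𝟙 r
        × (∀ k → State.ψ σ′ k ℕ.≤ State.ψ σ k ℕ.+ amountFor k d))
    step-invariant s nothing {R} inv =
      R , inv , ≡.sym (ℕ.+-identityʳ (Sumℕ.sum R)) , λ k → ℕ.m≤m+n _ 0
    step-invariant s (just (i , a)) {R} {σ} inv
      with is-just (State.single σ i) ∨ is-just (State.combo σ) in covered
    ... | true  = R , inv , m≡m+n*0 (Sumℕ.sum R) a , λ k → ℕ.m≤m+n _ _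
    ... | false with λc ≤? counter (updateAt (State.ψ σ) i (ℕ._+ a))
    ...   | yes λc≤ψ꜀ = R , record
      { R≤ψ       = λ k → ℕ.≤-trans (R≤ψ k) (ψ≤updateAt i a ψ k)
      ; R≤λs      = R≤λs
      ; purchased = λ k b → ≤-trans (purchased k b) (fromℕ-mono-≤ (ψ≤updateAt i a ψ k))
      -- A combo purchase changes neither `R` nor `single`, so the old bound carries over although
      -- the counter has passed `λc`.
      ; charge≤λc = charge≤λc
      ; combined  = λ _ → λc≤ψ꜀
      } , m≡m+n*0 (Sumℕ.sum R) a , updateAt≤ψ+amountFor i a ψ
      where
      open State σ
      open Invariant inv
    ...   | no λc≰ψ꜀ with λs i ≤? fromℕ (updateAt (State.ψ σ) i (ℕ._+ a) i)
    ...     | yes λs≤ψ = R , record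
      { R≤ψ       = R≤ψ′
      ; R≤λs      = R≤λs
      ; purchased = purchased′
      ; charge≤λc = below-counter R≤ψ′ R≤λs purchased′ (≰⇒≥ λc≰ψ꜀)
      -- An uncovered demand excludes an earlier combo, and this branch leaves `combo` as it was.
      ; combined  = λ made → contradiction (≡.trans (≡.sym made) (∨-conicalʳ _ _ covered)) λ ()
      } , m≡m+n*0 (Sumℕ.sum R) a , updateAt≤ψ+amountFor i a ψ
      where
      open State σ
      open Invariant inv
      R≤ψ′ : ∀ k → R k ℕ.≤ updateAt ψ i (ℕ._+ a) k
      R≤ψ′ k = ℕ.≤-trans (R≤ψ k) (ψ≤updateAt i a ψ k)
      purchased′ : ∀ k → is-just (updateAt single i (λ _ → just s) k) ≡ true →
        λs k ≤ fromℕ (updateAt ψ i (ℕ._+ a) k)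
      purchased′ = updateAt-elim (λ k τ → is-just τ ≡ true → λs k ≤ fromℕ (updateAt ψ i (ℕ._+ a) k)) i
        (λ _ → λs≤ψ) (λ k _ b → ≤-trans (purchased k b) (fromℕ-mono-≤ (ψ≤updateAt i a ψ k)))
    ...     | no λs≰ψ = updateAt R i (ℕ._+ a) , record
      { R≤ψ       = R≤ψ′
      ; R≤λs      = R≤λs′
      ; purchased = purchased′
      ; charge≤λc = below-counter R≤ψ′ R≤λs′ purchased′ (≰⇒≥ λc≰ψ꜀)
      ; combined  = λ made → contradiction (≡.trans (≡.sym made) (∨-conicalʳ _ _ covered)) λ ()
      } , ≡.trans (sum-updateAt i a R) (≡.cong (Sumℕ.sum R ℕ.+_) (≡.sym (ℕ.*-identityʳ a))) ,
      updateAt≤ψ+amountFor i a ψ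
      where
      open State σ
      open Invariant inv
      R+a≤ψ+a : R i ℕ.+ a ℕ.≤ updateAt ψ i (ℕ._+ a) i
      R+a≤ψ+a = ℕ.≤-trans (ℕ.+-monoˡ-≤ a (R≤ψ i)) (ℕ.≤-reflexive (≡.sym (updateAt-updates i ψ)))
      R≤ψ′ : ∀ k → updateAt R i (ℕ._+ a) k ℕ.≤ updateAt ψ i (ℕ._+ a) k
      R≤ψ′ = updateAt-elim (λ k x → x ℕ.≤ updateAt ψ i (ℕ._+ a) k) i
        R+a≤ψ+a (λ k _ → ℕ.≤-trans (R≤ψ k) (ψ≤updateAt i a ψ k))
      -- Renting follows a failed threshold test, so the updated counter of `i`, which dominates the
      -- updated rent, is at most `λs i`.
      R≤λs′ : ∀ k → fromℕ (updateAt R i (ℕ._+ a) k) ≤ λs k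
      R≤λs′ = updateAt-elim (λ k x → fromℕ x ≤ λs k) i
        (≤-trans (fromℕ-mono-≤ R+a≤ψ+a) (≰⇒≥ λs≰ψ)) (λ k _ → R≤λs k)
      purchased′ : ∀ k → is-just (single k) ≡ true → λs k ≤ fromℕ (updateAt ψ i (ℕ._+ a) k)
      purchased′ k b = ≤-trans (purchased k b) (fromℕ-mono-≤ (ψ≤updateAt i a ψ k))

    run-invariant : ∀ {T} s (D : Demands T) {R σ} → Invariant R σ → let rs , σ′ = run θ y s D σ in
      Σ[ R′ ∈ Vector ℕ K ] (Invariant R′ σ′
        × Sumℕ.sum R′ ≡ Sumℕ.sum R ℕ.+ Sumℕ.sum (λ j → amount (D j) ℕ.* 𝟙 (rs j))
        × (∀ k → State.ψ σ′ k ℕ.≤ State.ψ σ k ℕ.+ totalDemand D k))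
    run-invariant {ℕ.zero}  s D {R} inv = R , inv , ≡.sym (ℕ.+-identityʳ (Sumℕ.sum R)) , λ k → ℕ.m≤m+n _ 0
    run-invariant {ℕ.suc T} s D {R} {σ} inv =
      let R₁ , inv₁ , sum₁ , ψ₁≤ = step-invariant s (head D) inv
          R₂ , inv₂ , sum₂ , ψ₂≤ = run-invariant (ℕ.suc s) (tail D) inv₁
      in R₂ , inv₂ ,
         ≡.trans sum₂ (≡.trans (≡.cong (ℕ._+ _) sum₁) (ℕ.+-assoc (Sumℕ.sum R) _ _)) ,
         λ k → ℕ.≤-trans (ψ₂≤ k) (ℕ.≤-trans (ℕ.+-monoˡ-≤ _ (ψ₁≤ k))
                                        (ℕ.≤-reflexive (ℕ.+-assoc (State.ψ σ k) _ _)))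

    -- From the final state of the run to the competitive bounds.

    module _ {T} (D : Demands T) where
      open Solution (LADTSR θ y D) using (rent; single; combo)

      -- The run invariant supplies the online data. The optimum enters through its witness `S`, a
      -- feasible solution of cost `opt` to which the offline lower bound applies.
      outcome : ∀ {opt} → IsOPT D opt →
        Σ[ cost′ ∈ Vector Carrier K ] Σ[ comboCost ∈ Carrier ]
        Σ[ ψ ∈ Vector Carrier K ] Σ[ charge′ ∈ Vector Carrier K ]
          (fromℕ (𝒞 D (LADTSR θ) y) ≈ sum cost′ + comboCost
          × Outcome (fromℕ Cₛ) (fromℕ C꜀) λc comboCost (fromℕ opt)
                    y (fromℕ ∘ totalDemand D) ψ λs cost′ charge′)
      outcome {opt} ((S , feasible , cost≡opt) , _) with run-invariant 0 D initial-invariant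
      ... | R , inv , sum≡ , ψ≤ = fromℕ ∘ itemCost , fromℕ comboCost , fromℕ ∘ ψ , charge R single ,
        trans (reflexive (≡.cong fromℕ cost≡))
              (trans (fromℕ-+ (Sumℕ.sum itemCost) comboCost) (+-congʳ (fromℕ-sum itemCost))) ,
        record
          { items      = item
          ; 0≤C        = 0≤fromℕ C꜀
          ; threshold꜀ = threshold-combo
          ; charge≤λ꜀  = charge≤λc
          ; combo      = combo-status
          ; lowerBound = lowerBound
          }
        where
        open Invariant inv
        ψ : Vector ℕ K
        ψ = State.ψ (proj₂ (run θ y 0 D (initial θ y)))

        itemCost : Vector ℕ K
        itemCost k = R k ℕ.+ Cₛ ℕ.* 𝟙 (madeBy (single k) T)

        rentalCost singleCost comboCost : ℕ
        rentalCost = Sumℕ.sum (λ j → amount (D j) ℕ.* 𝟙 (rent j))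
        singleCost = Sumℕ.sum (λ k → Cₛ ℕ.* 𝟙 (madeBy (single k) T))
        comboCost  = C꜀ ℕ.* 𝟙 (madeBy combo T)

        -- As `R` starts at zero, its final entries sum to the total rent, so rents and single
        -- purchases can be regrouped by item.
        cost≡ : 𝒞 D (LADTSR θ) y ≡ Sumℕ.sum itemCost ℕ.+ comboCost
        cost≡ = ≡.cong (ℕ._+ comboCost) (≡.trans
          (≡.cong (ℕ._+ singleCost) (≡.sym (≡.trans sum≡
            (≡.cong (ℕ._+ rentalCost) (Sumℕ.sum-replicate-zero K)))))
          (≡.sym (Sumℕ.∑-distrib-+ R (λ k → Cₛ ℕ.* 𝟙 (madeBy (single k) T)))))

        m*𝟙≤m : ∀ m b → m ℕ.* 𝟙 b ℕ.≤ m
        m*𝟙≤m m true  = ℕ.≤-reflexive (ℕ.*-identityʳ m)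
        m*𝟙≤m m false = ℕ.≤-trans (ℕ.≤-reflexive (ℕ.*-zeroʳ m)) ℕ.z≤n

        m*0≤0 : ∀ m → fromℕ (m ℕ.* 0) ≤ 0#
        m*0≤0 m = ≤-reflexive (reflexive (≡.cong fromℕ (ℕ.*-zeroʳ m)))

        item-status : ∀ k →
            (fromℕ (itemCost k) ≤ charge R single k × charge R single k ≤ fromℕ (ψ k)
              × charge R single k ≤ λs k)
          ⊎ (fromℕ (itemCost k) ≤ λs k + fromℕ Cₛ × λs k ≤ fromℕ (ψ k) × λs k ≤ charge R single k)
        item-status k with single k | purchased k
        ... | nothing | _     = inj₁
          ( ≤-reflexive (reflexive (≡.cong fromℕ (≡.sym (m≡m+n*0 (R k) Cₛ))))
          , fromℕ-mono-≤ (R≤ψ k) , R≤λs k )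
        -- Bounding the indicator of `t` by 1 spares the invariant any record of purchase times.
        ... | just t  | λs≤ψ = inj₂
          ( ≤-trans (≤-reflexive (fromℕ-+ (R k) _)) (+-mono-≤ (R≤λs k) (fromℕ-mono-≤ (m*𝟙≤m Cₛ (t ℕ.<ᵇ T))))
          , λs≤ψ ≡.refl , ≤-refl )

        0≤charge : ∀ k → 0# ≤ charge R single k
        0≤charge k with is-just (single k)
        ... | true  = 0≤λs k
        ... | false = 0≤fromℕ (R k)

        item : ∀ k → Item (fromℕ Cₛ) (y k) (fromℕ (totalDemand D k)) (fromℕ (ψ k)) (λs k)
                          (fromℕ (itemCost k)) (charge R single k)
        item k = record
          { 0≤s       = 0≤fromℕ Cₛ
          ; 0≤z       = 0≤fromℕ (totalDemand D k)
          ; ψ≤z       = fromℕ-mono-≤ (ψ≤ k)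
          ; 0≤cost    = 0≤fromℕ (itemCost k)
          ; 0≤charge  = 0≤charge k
          ; threshold = threshold-single k
          ; status    = item-status k
          }

        combo-status : fromℕ comboCost ≤ 0#
          ⊎ (fromℕ comboCost ≤ fromℕ C꜀ × λc ≤ counter ψ)
        combo-status with combo | combined
        ... | nothing | _     = inj₁ (m*0≤0 C꜀)
        ... | just t  | λc≤ψ꜀ = inj₂ (fromℕ-mono-≤ (m*𝟙≤m C꜀ (t ℕ.<ᵇ T)) , λc≤ψ꜀ ≡.refl)

        lowerBound : fromℕ C꜀ ≤ fromℕ opt ⊎ ∑[ k < K ] min (fromℕ Cₛ) (fromℕ (totalDemand D k)) ≤ fromℕ opt
        lowerBound with OfflineBound.cost-lowerBound I D S feasible
        ... | inj₁ C≤cost = inj₁ (fromℕ-mono-≤ (ℕ.≤-trans C≤cost (ℕ.≤-reflexive cost≡opt)))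
        ... | inj₂ X≤cost = inj₂ (≤-trans (sum-mono-≤ (λ k → min-fromℕ Cₛ (totalDemand D k)))
          (≤-trans (≤-reflexive (sym (fromℕ-sum (λ k → Cₛ ℕ.⊓ totalDemand D k))))
                   (fromℕ-mono-≤ (ℕ.≤-trans X≤cost (ℕ.≤-reflexive cost≡opt)))))

      -- The form without division by the optimum also covers `opt` equal to 0, which consistency
      -- has to allow.
      LADTSR-smooth : ∀ {opt} → IsOPT D opt → fromℕ (𝒞 D (LADTSR θ) y)
        ≤ (1# + θ + θ ^ 2) * fromℕ opt + (1# + fromℕ 2 * θ) / (1# - θ) * error y D
      LADTSR-smooth isOPT with outcome isOPT
      ... | _ , _ , _ , _ , cost≈ , o = ≤-trans (≤-reflexive cost≈) (smooth-bound o)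

      LADTSR-robust : ∀ {opt} → IsOPT D opt → fromℕ (𝒞 D (LADTSR θ) y) ≤ (1# + θ ⁻¹ + (θ ⁻¹) ^ 3) * fromℕ opt
      LADTSR-robust isOPT with outcome isOPT
      ... | _ , _ , _ , _ , cost≈ , o = ≤-trans (≤-reflexive cost≈) (robust-bound o)

-- The ratio bound, consistency and robustness.

theorem4p1 : ∀ {c ℓ₁ ℓ₂} (F : OrderedField c ℓ₁ ℓ₂) (I : Instance) →
    let open OrderedField F
        open SkiRental I
        open LearningAugmented F I
    in (θ : Carrier) → 0# < θ → θ < 1# →
       (∀ {T} (D : Demands T) (y : Prediction) → NonNegative y →
          ∀ opt → IsOPT D opt → 0 ℕ.< opt →
          fromℕ (𝒞 D (LADTSR θ) y) / fromℕ opt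
            ≤ min (1# + θ + θ ^ 2 + (1# + fromℕ 2 * θ) / (1# - θ) * (error y D / fromℕ opt))
                  (1# + θ ⁻¹ + (θ ⁻¹) ^ 3))
       × Consistent (1# + θ + θ ^ 2) (LADTSR θ)
       × Robust (1# + θ ⁻¹ + (θ ⁻¹) ^ 3) (LADTSR θ)
theorem4p1 F I θ 0<θ θ<1 = ratio , consistent , λ D y _ opt isOPT → LADTSR-robust y D isOPT
  where
  open OrderedField F
  open OrderedFieldProperties F
  open SkiRental I
  open LearningAugmented F I
  open Online F I 0<θ θ<1

  ratio : ∀ {T} (D : Demands T) (y : Prediction) → NonNegative y →
    ∀ opt → IsOPT D opt → 0 ℕ.< opt →
    fromℕ (𝒞 D (LADTSR θ) y) / fromℕ opt
      ≤ min (1# + θ + θ ^ 2 + (1# + fromℕ 2 * θ) / (1# - θ) * (error y D / fromℕ opt))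
            (1# + θ ⁻¹ + (θ ⁻¹) ^ 3)
  ratio D y _ opt isOPT 0<opt = min-glb
    (begin
      fromℕ (𝒞 D (LADTSR θ) y) / v
        ≤⟨ *-monoˡ-≤ 0≤v⁻¹ (LADTSR-smooth y D isOPT) ⟩
      (β * v + κ * error y D) / v
        ≈⟨ solve 5 (λ b v k e v′ → (b :* v :+ k :* e) :* v′ := b :* (v :* v′) :+ k :* (e :* v′))
             refl β v κ (error y D) (v ⁻¹) ⟩
      β * (v * v ⁻¹) + κ * (error y D / v)
        ≈⟨ +-congʳ (trans (*-congˡ v*v⁻¹≈1) (*-identityʳ β)) ⟩
      β + κ * (error y D / v)
        ∎)
    (begin
      fromℕ (𝒞 D (LADTSR θ) y) / v  ≤⟨ *-monoˡ-≤ 0≤v⁻¹ (LADTSR-robust y D isOPT) ⟩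
      ρ * v / v                     ≈⟨ *-assoc ρ v (v ⁻¹) ⟩
      ρ * (v * v ⁻¹)                ≈⟨ trans (*-congˡ v*v⁻¹≈1) (*-identityʳ ρ) ⟩
      ρ                             ∎)
    where
    v β κ ρ : Carrier
    v = fromℕ opt
    β = 1# + θ + θ ^ 2
    κ = (1# + fromℕ 2 * θ) / (1# - θ)
    ρ = 1# + θ ⁻¹ + (θ ⁻¹) ^ 3
    0≤v⁻¹ : 0# ≤ v ⁻¹
    0≤v⁻¹ = ⁻¹-nonNegative (fromℕ-positive 0<opt)
    v*v⁻¹≈1 : v * v ⁻¹ ≈ 1#
    v*v⁻¹≈1 = x*x⁻¹≈1 (fromℕ-positive 0<opt)

  consistent : Consistent (1# + θ + θ ^ 2) (LADTSR θ)
  consistent D y _ error≈0 opt isOPT = ≤-trans (LADTSR-smooth y D isOPT)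
    (≤-reflexive (trans (+-congˡ (trans (*-congˡ error≈0) (zeroʳ _))) (+-identityʳ _)))
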